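{- There is no cubic vertex-transitive tricirculant of Type 4 of order at least $54$.
   Context: All graphs are finite and simple; cubic means connected and $3$-regular; a tricirculant is a connected graph admitting a cyclic group of automorphisms with exactly three vertex-orbits, all of equal size larger than $1$. For a positive integer $k$ and $r,s\in\mathbb{Z}_{2k}$, $T_4(k,r,s)$ is the graph with vertex set $\{u_i,v_i,w_i: i\in\mathbb{Z}_{2k}\}$ and edges $u_iu_{i+k}$, $u_iv_i$, $u_iw_i$, $w_iw_{i+r}$, $v_iv_{i+s}$ ($i\in\mathbb{Z}_{2k}$). A cubic tricirculant is of Type 4 if it is isomorphic to $T_4(k,r,s)$ for some positive integer $k$ and some $r,s\in\mathbb{Z}_{2k}$. -}

module Defs where

open import Level using (0ℓ)
open import Data.Nat using (ℕ; zero; suc; _+_; _*_; _<_; _≤_; NonZero)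
open import Data.Nat.Properties using (m*n≢0)
open import Data.Nat.DivMod using (_mod_)
open import Data.Fin using (Fin; toℕ)
open import Data.Product using (_×_; _,_; ∃; Σ)
open import Data.Sum using (_⊎_)
open import Function.Bundles using (_↔_; Inverse)
open import Relation.Nullary using (¬_)
open import Relation.Binary.PropositionalEquality using (_≡_)
open import Relation.Binary.Construct.Closure.ReflexiveTransitive using (Star)

module Graph {V : Set} (Adj : V → V → Set) where

  Simple : Set
  Simple = (∀ x → ¬ Adj x x) × (∀ x y → Adj x y → Adj y x)

  ThreeRegular : Set
  ThreeRegular = ∀ x → ∃ λ a → ∃ λ b → ∃ λ c →
      (¬ a ≡ b) × (¬ a ≡ c) × (¬ b ≡ c)
    × Adj x a × Adj x b × Adj x c
    × (∀ y → Adj x y → (y ≡ a) ⊎ (y ≡ b) ⊎ (y ≡ c))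

  Connected : Set
  Connected = ∀ x y → Star Adj x y

  Cubic : Set
  Cubic = Simple × Connected × ThreeRegular

  record Automorphism : Set where
    field
      perm     : V ↔ V
      preserve : ∀ x y → Adj x y → Adj (Inverse.to perm x) (Inverse.to perm y)
      reflect  : ∀ x y → Adj (Inverse.to perm x) (Inverse.to perm y) → Adj x y
  open Automorphism public

  apply : Automorphism → V → V
  apply σ = Inverse.to (perm σ)

  iter : (V → V) → ℕ → V → V
  iter f zero    x = x
  iter f (suc j) x = f (iter f j x)

  VertexTransitive : Set
  VertexTransitive = ∀ x y → Σ Automorphism λ σ → apply σ x ≡ y

  ThreeEqualOrbits : Automorphism → Set
  ThreeEqualOrbits σ = ∃ λ (m : ℕ) → (1 < m) × ∃ λ (x : Fin 3 → V) →
      (∀ t → iter (apply σ) m (x t) ≡ x t)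
    × (∀ t j → 0 < j → j < m → ¬ iter (apply σ) j (x t) ≡ x t)
    × (∀ t t' j j' → ¬ t ≡ t' → ¬ iter (apply σ) j (x t) ≡ iter (apply σ) j' (x t'))
    × (∀ y → ∃ λ t → ∃ λ j → iter (apply σ) j (x t) ≡ y)

  Tricirculant : Set
  Tricirculant = Connected × Σ Automorphism ThreeEqualOrbits

module T4 (k : ℕ) .{{_ : NonZero k}} where

  instance
    nz2k : NonZero (2 * k)
    nz2k = m*n≢0 2 k

  Z : Set
  Z = Fin (2 * k)

  _⊕_ : Z → Z → Z
  i ⊕ j = (toℕ i + toℕ j) mod (2 * k)

  kZ : Z
  kZ = k mod (2 * k)

  data Vertex : Set where
    u v w : Z → Vertex

  data Edge (r s : Z) : Vertex → Vertex → Set where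
    uu : ∀ i → Edge r s (u i) (u (i ⊕ kZ))
    uv : ∀ i → Edge r s (u i) (v i)
    uw : ∀ i → Edge r s (u i) (w i)
    ww : ∀ i → Edge r s (w i) (w (i ⊕ r))
    vv : ∀ i → Edge r s (v i) (v (i ⊕ s))

  Adj : (r s : Z) → Vertex → Vertex → Set
  Adj r s x y = Edge r s x y ⊎ Edge r s y x

{-# OPTIONS --safe #-}
module Submission where

-- A closed non-backtracking walk in T₄(k,r,s) is recorded by an offset (a, b, e): it closes up
-- exactly when a r + b s + e k ≡ 0 (mod 2k).  For walks of length 8 and 10 every pair of edges at a
-- vertex lies on one with offset zero, except possibly {uv, uw}, {ww, ww} and {vv, vv}.  If {uv, uw}
-- lay on none, an automorphism taking w to u would have to turn the edge wu into uu′, which is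
-- impossible because u′ is again a u-vertex.  So {uv, uw} lies on such walks of both lengths, and then
-- by transitivity {ww, ww} and {vv, vv} lie on octagons.  The octagons through {uv, uw} force
-- s ∈ {±3r, ±r, ±r + k, ±2r + k} or the same with r and s exchanged; then one generator g and k span
-- ℤ/2k, each further relation x g + e k ≡ 0 gives k ∣ x, and since k ≥ 9 only finitely many cases
-- remain.  They are contradictory, except for s = ±r, where hexagons pass through {uw, ww} but not
-- through uu′.

open import Defs
open import Data.Nat as ℕ using (ℕ; zero; suc; NonZero)
import Data.Nat.Properties as ℕ
import Data.Nat.Divisibility as ℕ
open import Data.Integer using (ℤ; +_; -_; _+_; _-_; 0ℤ; 1ℤ; -1ℤ) renaming (∣_∣ to abs)
import Data.Integer.Properties as ℤ
open import Data.Integer.DivMod using (_/ℕ_; _%ℕ_; n%ℕd<d; a≡a%ℕn+[a/ℕn]*n)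
open import Data.Integer.Divisibility.Signed
open import Data.Integer.Tactic.RingSolver using (solve-∀)
open import Data.Fin using (Fin; toℕ; fromℕ<; punchOut) renaming (_≟_ to _≟ᶠ_)
open import Data.Fin.Patterns
open import Data.Fin.Properties using (all?; toℕ-fromℕ<; toℕ-injective; toℕ<n; injective⇒≤; punchOut-injective)
  renaming (any? to any?ᶠ)
open import Data.List using (List; []; _∷_; [_]; _++_)
open import Data.List.Relation.Unary.Any as Any using (Any; any?; here; there)
import Data.List.Relation.Unary.Any.Properties as Any
open import Data.List.Relation.Unary.All as All using (All; []; _∷_)
open import Data.Empty using (⊥)
open import Data.Product using (_×_; _,_; Σ; ∃; proj₁; proj₂)
open import Data.Sum using (_⊎_; inj₁; inj₂; [_,_]′)
open import Function.Bundles using (Inverse)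
open import Relation.Nullary using (¬_; Dec; yes; no; contradiction)
open import Relation.Nullary.Decidable using (_×-dec_; _⊎-dec_; _→-dec_; ¬?; from-yes)
open import Relation.Binary.Construct.Closure.ReflexiveTransitive using (Star; ε; _◅_)
open import Relation.Binary.PropositionalEquality
  using (_≡_; _≢_; refl; sym; trans; cong; cong₂; subst; subst₂; module ≡-Reasoning)

-- Kinds of vertices, ports and displacements

data Kind : Set where
  𝕦 𝕧 𝕨 : Kind

_≟ᵏ_ : (t t′ : Kind) → Dec (t ≡ t′)
𝕦 ≟ᵏ 𝕦 = yes refl
𝕦 ≟ᵏ 𝕧 = no λ ()
𝕦 ≟ᵏ 𝕨 = no λ ()
𝕧 ≟ᵏ 𝕦 = no λ ()
𝕧 ≟ᵏ 𝕧 = yes refl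
𝕧 ≟ᵏ 𝕨 = no λ ()
𝕨 ≟ᵏ 𝕦 = no λ ()
𝕨 ≟ᵏ 𝕧 = no λ ()
𝕨 ≟ᵏ 𝕨 = yes refl

-- Ports number the edges at a vertex: u′, v, w at u; u, +s, −s at v; u, +r, −r at w.
Port : Set
Port = Fin 3

-- (a , b , e) stands for the displacement a r + b s + e k.
Offset : Set
Offset = ℤ × ℤ × ℤ

_⊞_ : Offset → Offset → Offset
(a , b , e) ⊞ (a′ , b′ , e′) = a + a′ , b + b′ , e + e′

next : Kind → Port → Kind
next 𝕦 0F = 𝕦
next 𝕦 1F = 𝕧
next 𝕦 2F = 𝕨
next 𝕧 0F = 𝕦
next 𝕧 _  = 𝕧
next 𝕨 0F = 𝕦
next 𝕨 _  = 𝕨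

shift : Kind → Port → Offset
shift 𝕦 0F = 0ℤ , 0ℤ , 1ℤ
shift 𝕧 1F = 0ℤ , 1ℤ , 0ℤ
shift 𝕧 2F = 0ℤ , -1ℤ , 0ℤ
shift 𝕨 1F = 1ℤ , 0ℤ , 0ℤ
shift 𝕨 2F = -1ℤ , 0ℤ , 0ℤ
shift _ _  = 0ℤ , 0ℤ , 0ℤ

-- The port that the same edge has at its far end: +s or +r is undone by -s or -r, and uu′ by
-- itself. A walk avoids backtracking by never leaving through it.
back : Kind → Port → Port
back 𝕦 _  = 0F
back 𝕧 0F = 1F
back 𝕨 0F = 2F
back _ 1F = 2F
back _ 2F = 1F

other₁ other₂ : Port → Port
other₁ 0F = 1F
other₁ 1F = 2F
other₁ 2F = 0F
other₂ 0F = 2F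
other₂ 1F = 0F
other₂ 2F = 1F

other-port : ∀ {p q} → p ≢ q → q ≡ other₁ p ⊎ q ≡ other₂ p
other-port {0F} {0F} p≢q = contradiction refl p≢q
other-port {0F} {1F} _   = inj₁ refl
other-port {0F} {2F} _   = inj₂ refl
other-port {1F} {0F} _   = inj₂ refl
other-port {1F} {1F} p≢q = contradiction refl p≢q
other-port {1F} {2F} _   = inj₁ refl
other-port {2F} {0F} _   = inj₁ refl
other-port {2F} {1F} _   = inj₂ refl
other-port {2F} {2F} p≢q = contradiction refl p≢q

other₁-≢ : ∀ p → p ≢ other₁ p
other₁-≢ 0F ()
other₁-≢ 1F ()
other₁-≢ 2F ()

other₂-≢ : ∀ p → p ≢ other₂ p
other₂-≢ 0F ()
other₂-≢ 1F ()
other₂-≢ 2F ()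

third-port? : Dec (∀ (p q i : Port) → p ≢ q → p ≢ 0F → q ≢ 0F → i ≢ p → i ≢ q → i ≡ 0F)
third-port? = all? λ p → all? λ q → all? λ i →
  ¬? (p ≟ᶠ q) →-dec ¬? (p ≟ᶠ 0F) →-dec ¬? (q ≟ᶠ 0F) →-dec
  ¬? (i ≟ᶠ p) →-dec ¬? (i ≟ᶠ q) →-dec (i ≟ᶠ 0F)

third-port : ∀ p q i → p ≢ q → p ≢ 0F → q ≢ 0F → i ≢ p → i ≢ q → i ≡ 0F
third-port = from-yes third-port?

-- Enumeration of closed non-backtracking walks

stopAt : ∀ {A B : Set} → Dec A → Dec B → Offset → List Offset
stopAt (yes _) (yes _) o = [ o ]
stopAt _       _       _ = []

-- Offsets of the n-step continuations of a walk that stands at kind t with offset o, having entered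
-- through port p, and that end at kind t* after entering through port p*.
endings : Kind → Port → ℕ → Kind → Port → Offset → List Offset
endings t* p* zero    t p o = stopAt (t ≟ᵏ t*) (p ≟ᶠ p*) o
endings t* p* (suc n) t p o = go (other₁ p) ++ go (other₂ p)
  where
  go : Port → List Offset
  go j = endings t* p* n (next t j) (back t j) (o ⊞ shift t j)

-- Offsets of the (n + 1)-step walks that leave kind t through port q and return to it through port p.
returns : ℕ → Kind → Port → Port → List Offset
returns n t p q = endings t p n (next t q) (back t q) (shift t q)

-- These displacements are 0 modulo 2k for all k, r and s, so a walk with such an offset closes in
-- every graph of the family.
Trivial : Offset → Set
Trivial (a , b , e) = a ≡ 0ℤ × b ≡ 0ℤ × + 2 ∣ e

trivial? : ∀ o → Dec (Trivial o)
trivial? (a , b , e) = (a ℤ.≟ 0ℤ) ×-dec (b ℤ.≟ 0ℤ) ×-dec (+ 2 ∣? e)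

detour? : ∀ n t → Dec (∀ p q → p ≢ q → p ≡ 0F ⊎ q ≡ 0F → Any Trivial (returns n t p q))
detour? n t = all? λ p → all? λ q →
  ¬? (p ≟ᶠ q) →-dec ((p ≟ᶠ 0F) ⊎-dec (q ≟ᶠ 0F)) →-dec any? trivial? (returns n t p q)

-- Settled by enumeration. The walks to think of cross uu′, go out to a v-vertex, make one step ±s,
-- return to u, cross uu′ again and undo the step; their offset is (0, 0, 2). The same works with w
-- and r.
detour₈ : ∀ t p q → p ≢ q → p ≡ 0F ⊎ q ≡ 0F → Any Trivial (returns 7 t p q)
detour₈ 𝕦 = from-yes (detour? 7 𝕦)
detour₈ 𝕧 = from-yes (detour? 7 𝕧)
detour₈ 𝕨 = from-yes (detour? 7 𝕨)

-- The same walks with two steps ±s or ±r in place of one.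
detour₁₀ : ∀ t p q → p ≢ q → p ≡ 0F ⊎ q ≡ 0F → Any Trivial (returns 9 t p q)
detour₁₀ 𝕦 = from-yes (detour? 9 𝕦)
detour₁₀ 𝕧 = from-yes (detour? 9 𝕧)
detour₁₀ 𝕨 = from-yes (detour? 9 𝕨)

-- Finite case analysis of the linear relations

-- r = c₁ g + d₁ k and s = c₂ g + d₂ k modulo 2k.
record Config : Set where
  constructor config
  field c₁ d₁ c₂ d₂ : ℤ

module _ where

  open import Data.Integer using (_*_)

  -- A pair (x , e) stands for x g + e k.
  reduce : Config → Offset → ℤ × ℤ
  reduce (config c₁ d₁ c₂ d₂) (a , b , e) = a * c₁ + b * c₂ , a * d₁ + b * d₂ + e

  Vanishing : ℤ × ℤ → Set
  Vanishing (x , e) = x ≡ 0ℤ × + 2 ∣ e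

  vanishing? : ∀ y → Dec (Vanishing y)
  vanishing? (x , e) = (x ℤ.≟ 0ℤ) ×-dec (+ 2 ∣? e)

  -- What x g + e k ≡ 0 (mod 2k) entails when g and k span ℤ/2k and g ≡ ρ (mod 2).
  Small : ℕ → ℤ → ℤ × ℤ → Set
  Small k ρ (x , e) = + k ∣ x × + 2 * + k ∣ x * ρ + e * + k

  small? : ∀ k ρ y → Dec (Small k ρ y)
  small? k ρ (x , e) = (+ k ∣? x) ×-dec (+ 2 * + k ∣? x * ρ + e * + k)

  -- The same when k ≥ 25.
  Large : ℤ × ℤ → Set
  Large (x , e) = Vanishing (x , e) ⊎ 25 ℕ.≤ abs x

  large? : ∀ y → Dec (Large y)
  large? (x , e) = vanishing? (x , e) ⊎-dec (25 ℕ.≤? abs x)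

  Solvable : Config → (ℤ × ℤ → Set) → List Offset → Set
  Solvable c Q = Any (λ o → Q (reduce c o))

  solvable? : ∀ c {Q} → (∀ y → Dec (Q y)) → ∀ l → Dec (Solvable c Q l)
  solvable? c Q? = any? (λ o → Q? (reduce c o))

  -- The case 2 ∣ k, ρ = 0 is exempt: there g and k do not span ℤ/2k.
  Unsolvable : Config → List (List Offset) → Set
  Unsolvable c ls =
    ¬ All (Solvable c Large) ls ×
    (∀ (i : Fin 16) → let k = 9 ℕ.+ toℕ i in
      ¬ All (Solvable c (Small k 1ℤ)) ls ×
      (+ 2 ∣ + k ⊎ ¬ All (Solvable c (Small k 0ℤ)) ls))

  unsolvable? : ∀ c ls → Dec (Unsolvable c ls)
  unsolvable? c ls =
    ¬? (All.all? (solvable? c large?) ls) ×-dec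
    all? λ i → let k = 9 ℕ.+ toℕ i in
      ¬? (All.all? (solvable? c (small? k 1ℤ)) ls) ×-dec
      ((+ 2 ∣? + k) ⊎-dec ¬? (All.all? (solvable? c (small? k 0ℤ)) ls))

  -- Vertex-transitivity forces octagons through {vv, vv} and {ww, ww} and a decagon through {uv,
  -- uw}; these three cannot all close for a common k ≥ 9.
  Refuted₈ : Config → Set
  Refuted₈ c = Unsolvable c (returns 7 𝕧 1F 2F ∷ returns 7 𝕨 1F 2F ∷ returns 9 𝕦 1F 2F ∷ [])

  -- Meant for s = ±r, where u w w u v v is a hexagon for every k: the pairs of wu with a ww edge
  -- lie on hexagons, whereas for k ≥ 9 no hexagon passes through uu′.
  Refuted₆ : Config → Set
  Refuted₆ c =
    (∀ p q → p ≢ q → p ≡ 0F ⊎ q ≡ 0F → Solvable c Vanishing (returns 5 𝕨 p q)) ×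
    Unsolvable c (returns 5 𝕦 0F 1F ∷ []) × Unsolvable c (returns 5 𝕦 0F 2F ∷ [])

  Refuted : Config → Set
  Refuted c = Refuted₈ c ⊎ Refuted₆ c

  refuted? : ∀ c → Dec (Refuted c)
  refuted? c = unsolvable? c _ ⊎-dec
    ((all? λ p → all? λ q → ¬? (p ≟ᶠ q) →-dec ((p ≟ᶠ 0F) ⊎-dec (q ≟ᶠ 0F)) →-dec
       solvable? c vanishing? (returns 5 𝕨 p q))
     ×-dec unsolvable? c _ ×-dec unsolvable? c _)

  -- Holding of the offset lets one solve for s (b = ±1), for r (a = ±1), or, after halving, for s up
  -- to a multiple of k (a, b = ±2, e = 0).
  Impossible : Offset → Set
  Impossible (a , b , e) =
    (b * b ≡ 1ℤ × Refuted (config 1ℤ 0ℤ (- (b * a)) (- (b * e)))) ⊎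
    (a * a ≡ 1ℤ × Refuted (config (- (a * b)) (- (a * e)) 1ℤ 0ℤ)) ⊎
    (a ≡ + 2 * a′ × b ≡ + 2 * b′ × e ≡ 0ℤ × b′ * b′ ≡ 1ℤ ×
     Refuted (config 1ℤ 0ℤ (- (b′ * a′)) 0ℤ) × Refuted (config 1ℤ 0ℤ (- (b′ * a′)) 1ℤ))
    where
    a′ b′ : ℤ
    a′ = a /ℕ 2
    b′ = b /ℕ 2

  impossible? : ∀ o → Dec (Impossible o)
  impossible? (a , b , e) =
    ((b * b ℤ.≟ 1ℤ) ×-dec refuted? _) ⊎-dec
    ((a * a ℤ.≟ 1ℤ) ×-dec refuted? _) ⊎-dec
    ((a ℤ.≟ _) ×-dec (b ℤ.≟ _) ×-dec (e ℤ.≟ 0ℤ) ×-dec (_ ℤ.≟ 1ℤ) ×-dec refuted? _ ×-dec refuted? _)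

  -- All candidates for an octagon through {uv, uw} are dealt with here by evaluation. A trivial
  -- offset would satisfy none of the alternatives of `Impossible`, so in particular none occurs in
  -- the list.
  all-impossible : All Impossible (returns 7 𝕦 1F 2F)
  all-impossible = from-yes (All.all? impossible? (returns 7 𝕦 1F 2F))

  parity : ∀ x → (∃ λ h → x ≡ 0ℤ + h * + 2) ⊎ (∃ λ h → x ≡ 1ℤ + h * + 2)
  parity x with x %ℕ 2 | n%ℕd<d x 2 | a≡a%ℕn+[a/ℕn]*n x 2
  ... | 0 | _ | eq = inj₁ (x /ℕ 2 , eq)
  ... | 1 | _ | eq = inj₂ (x /ℕ 2 , eq)
  ... | suc (suc _) | ℕ.s≤s (ℕ.s≤s ()) | _

-- Automorphisms acting on walks of an arbitrary graph

module Walks {V : Set} (Adj : V → V → Set) where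

  open Graph Adj

  -- NonBacktracking y z n a b: the edge a → b is continued by n steps, the last edge being y → z.
  data NonBacktracking (y z : V) : ℕ → V → V → Set where
    stop : NonBacktracking y z 0 y z
    step : ∀ {n a b c} → Adj b c → a ≢ c → NonBacktracking y z n b c → NonBacktracking y z (suc n) a b

  apply-injective : ∀ σ {x y} → apply σ x ≡ apply σ y → x ≡ y
  apply-injective σ {x} {y} eq = trans (sym (Inverse.strictlyInverseʳ (perm σ) x))
    (trans (cong (Inverse.from (perm σ)) eq) (Inverse.strictlyInverseʳ (perm σ) y))

  lift-neighbour : ∀ σ {x y} → Adj (apply σ x) y → ∃ λ z → Adj x z × apply σ z ≡ y
  lift-neighbour σ {x} {y} adj = from y , reflect σ x (from y) (subst (Adj _) (sym to∘from) adj) , to∘from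
    where
    from = Inverse.from (perm σ)
    to∘from = Inverse.strictlyInverseˡ (perm σ) y

  map-walk : ∀ σ {y z n a b} → NonBacktracking y z n a b →
    NonBacktracking (apply σ y) (apply σ z) n (apply σ a) (apply σ b)
  map-walk σ stop = stop
  map-walk σ (step adj a≢c walk) =
    step (preserve σ _ _ adj) (λ eq → a≢c (apply-injective σ eq)) (map-walk σ walk)

-- Congruence modulo 2k and the index set `Z`

module Residues (k : ℕ) .{{_ : NonZero k}} where

  open import Data.Integer using (_*_; _⊖_)
  open T4 k

  M : ℤ
  M = + 2 * + k

  +2k≡M : + (2 ℕ.* k) ≡ M
  +2k≡M = ℤ.pos-* 2 k

  infix 4 _≈_
  -- A record in place of bare divisibility, because x and y cannot be inferred from the difference
  -- alone.
  record _≈_ (x y : ℤ) : Set where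
    constructor congruent
    field difference : M ∣ x - y
  open _≈_ public

  ≈-reflexive : ∀ {x y} → x ≡ y → x ≈ y
  ≈-reflexive {x} refl = congruent (divides 0ℤ (ℤ.+-inverseʳ x))

  ≈-sym : ∀ {x y} → x ≈ y → y ≈ x
  ≈-sym {x} {y} (congruent h) = congruent (subst (M ∣_) (identity x y) (∣m⇒∣-m h))
    where
    identity : ∀ x y → - (x - y) ≡ y - x
    identity = solve-∀

  ≈-trans : ∀ {x y z} → x ≈ y → y ≈ z → x ≈ z
  ≈-trans {x} {y} {z} (congruent h) (congruent h′) =
    congruent (subst (M ∣_) (identity x y z) (∣m∣n⇒∣m+n h h′))
    where
    identity : ∀ x y z → (x - y) + (y - z) ≡ x - z
    identity = solve-∀

  ≈-+ : ∀ {x y x′ y′} → x ≈ y → x′ ≈ y′ → x + x′ ≈ y + y′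
  ≈-+ {x} {y} {x′} {y′} (congruent h) (congruent h′) =
    congruent (subst (M ∣_) (identity x y x′ y′) (∣m∣n⇒∣m+n h h′))
    where
    identity : ∀ x y x′ y′ → (x - y) + (x′ - y′) ≡ (x + x′) - (y + y′)
    identity = solve-∀

  ≈-* : ∀ a {x y} → x ≈ y → a * x ≈ a * y
  ≈-* a {x} {y} (congruent h) = congruent (subst (M ∣_) (identity a x y) (∣n⇒∣m*n a h))
    where
    identity : ∀ a x y → a * (x - y) ≡ a * x - a * y
    identity = solve-∀

  abstract

    pos : ℤ → Z
    pos x = fromℕ< (n%ℕd<d x (2 ℕ.* k))

    toℕ-pos : ∀ x → + toℕ (pos x) ≈ x
    toℕ-pos x = congruent (divides (- q) (begin
      + toℕ (pos x) - x                  ≡⟨ cong (λ n → + n - x) (toℕ-fromℕ< _) ⟩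
      + (x %ℕ (2 ℕ.* k)) - x             ≡⟨ identity (+ (x %ℕ (2 ℕ.* k))) _ x (a≡a%ℕn+[a/ℕn]*n x (2 ℕ.* k)) ⟩
      - (q * + (2 ℕ.* k))                ≡⟨ cong (λ m → - (q * m)) +2k≡M ⟩
      - (q * M)                          ≡⟨ ℤ.neg-distribˡ-* q M ⟩
      - q * M                            ∎))
      where
      open ≡-Reasoning
      q : ℤ
      q = x /ℕ (2 ℕ.* k)
      cancel : ∀ r m → r - (r + m) ≡ - m
      cancel = solve-∀
      identity : ∀ r m x → x ≡ r + m → r - x ≡ - m
      identity r m _ refl = cancel r m

    -- On natural numbers `_%ℕ_` computes to the remainder behind `_mod_`. The proof sits in the
    -- abstract block since only there does `pos` unfold.
    ⊕≡pos : ∀ i j → i ⊕ j ≡ pos (+ (toℕ i ℕ.+ toℕ j))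
    ⊕≡pos i j = refl

    kZ≡pos : kZ ≡ pos (+ k)
    kZ≡pos = refl

  -- The difference is less than 2k in absolute value, so divisibility by 2k makes it 0.
  toℕ-≈-injective : ∀ {i j : Z} → + toℕ i ≈ + toℕ j → i ≡ j
  toℕ-≈-injective {i} {j} (congruent h) with abs (toℕ i ⊖ toℕ j) in eq
  ... | zero = toℕ-injective (ℤ.+-injective (ℤ.i-j≡0⇒i≡j (+ toℕ i) (+ toℕ j)
          (trans (ℤ.m-n≡m⊖n (toℕ i) (toℕ j)) (ℤ.∣i∣≡0⇒i≡0 eq))))
  ... | suc d = contradiction (ℕ.≤-trans small (ℕ.∣⇒≤ divisor)) (ℕ.<-irrefl refl)
    where
    small : suc d ℕ.< 2 ℕ.* k
    small = subst (ℕ._< 2 ℕ.* k) eq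
      (ℕ.≤-<-trans (ℤ.∣m⊝n∣≤m⊔n (toℕ i) (toℕ j)) (ℕ.⊔-lub (toℕ<n i) (toℕ<n j)))
    divisor : 2 ℕ.* k ℕ.∣ suc d
    divisor = subst (2 ℕ.* k ℕ.∣_) (trans (cong abs (ℤ.m-n≡m⊖n (toℕ i) (toℕ j))) eq)
      (∣⇒∣ᵤ (subst (_∣ + toℕ i - + toℕ j) (sym +2k≡M) h))

  pos-cong : ∀ {x y} → x ≈ y → pos x ≡ pos y
  pos-cong {x} {y} h = toℕ-≈-injective (≈-trans (≈-trans (toℕ-pos x) h) (≈-sym (toℕ-pos y)))

  pos-injective : ∀ {x y} → pos x ≡ pos y → x ≈ y
  pos-injective {x} {y} eq =
    ≈-trans (≈-sym (toℕ-pos x)) (≈-trans (≈-reflexive (cong (λ i → + toℕ i) eq)) (toℕ-pos y))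

  pos-toℕ : ∀ i → i ≡ pos (+ toℕ i)
  pos-toℕ i = toℕ-≈-injective (≈-sym (toℕ-pos (+ toℕ i)))

  pos-⊕ : ∀ x j → pos x ⊕ j ≡ pos (x + + toℕ j)
  pos-⊕ x j = trans (⊕≡pos (pos x) j) (pos-cong (≈-+ (toℕ-pos x) (≈-reflexive {+ toℕ j} refl)))

  pos-⊕k : ∀ x → pos x ⊕ kZ ≡ pos (x + + k)
  pos-⊕k x = trans (⊕≡pos (pos x) kZ)
    (pos-cong (≈-+ (toℕ-pos x) (subst (λ i → + toℕ i ≈ + k) (sym kZ≡pos) (toℕ-pos (+ k)))))

-- A missed value could be punched out, which would embed `Fin (suc n)` into `Fin n`.
injective⇒surjective : ∀ {n} {f : Fin n → Fin n} → (∀ {i j} → f i ≡ f j → i ≡ j) → ∀ i → ∃ λ j → f j ≡ i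
injective⇒surjective {suc n} {f} injective i with any?ᶠ (λ j → f j ≟ᶠ i)
... | yes found = found
... | no missed = contradiction
  (injective⇒≤ {f = λ j → punchOut (avoids j)} λ {j} {j′} eq →
    injective (punchOut-injective (avoids j) (avoids j′) eq))
  ℕ.1+n≰n
  where
  avoids : ∀ j → i ≢ f j
  avoids j eq = missed (j , sym eq)

-- Integer coordinates on the graph

module Cover (k : ℕ) .{{_ : NonZero k}} (r s : T4.Z k) where

  open import Data.Integer using (_*_)
  open T4 k
  open Residues k
  open Graph (Adj r s)
  open Walks (Adj r s)

  K R S : ℤ
  K = + k
  R = + toℕ r
  S = + toℕ s

  ev : Offset → ℤ
  ev (a , b , e) = a * R + b * S + e * K

  Holds : Offset → Set
  Holds o = ev o ≈ 0ℤ

  ev-⊞ : ∀ o o′ → ev (o ⊞ o′) ≡ ev o + ev o′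
  ev-⊞ (a , b , e) (a′ , b′ , e′) = identity a b e a′ b′ e′ R S K
    where
    identity : ∀ a b e a′ b′ e′ R S K →
      (a + a′) * R + (b + b′) * S + (e + e′) * K ≡ (a * R + b * S + e * K) + (a′ * R + b′ * S + e′ * K)
    identity = solve-∀

  -- Indices are integers, reduced only inside `pos`, so that displacements along walks add up by
  -- ring identities.
  vertex : Kind → ℤ → Vertex
  vertex 𝕦 x = u (pos x)
  vertex 𝕧 x = v (pos x)
  vertex 𝕨 x = w (pos x)

  vertex-cong : ∀ t {x y} → x ≈ y → vertex t x ≡ vertex t y
  vertex-cong 𝕦 h = cong u (pos-cong h)
  vertex-cong 𝕧 h = cong v (pos-cong h)
  vertex-cong 𝕨 h = cong w (pos-cong h)

  u-injective : ∀ {i j : Z} → u i ≡ u j → i ≡ j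
  u-injective refl = refl

  v-injective : ∀ {i j : Z} → v i ≡ v j → i ≡ j
  v-injective refl = refl

  w-injective : ∀ {i j : Z} → w i ≡ w j → i ≡ j
  w-injective refl = refl

  vertex-injective : ∀ t t′ {x y} → vertex t x ≡ vertex t′ y → t ≡ t′ × x ≈ y
  vertex-injective 𝕦 𝕦 eq = refl , pos-injective (u-injective eq)
  vertex-injective 𝕧 𝕧 eq = refl , pos-injective (v-injective eq)
  vertex-injective 𝕨 𝕨 eq = refl , pos-injective (w-injective eq)

  neighbour : Kind → ℤ → Port → Vertex
  neighbour t x p = vertex (next t p) (x + ev (shift t p))

  neighbour-cong : ∀ t p {x y} → x ≈ y → neighbour t x p ≡ neighbour t y p
  neighbour-cong t p h = vertex-cong (next t p) (≈-+ h (≈-reflexive refl))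

  K+K≈0 : K + K ≈ 0ℤ
  K+K≈0 = congruent (divides 1ℤ (identity K))
    where
    identity : ∀ K → K + K - 0ℤ ≡ 1ℤ * (+ 2 * K)
    identity = solve-∀

  +ev-none : ∀ x → x + ev (0ℤ , 0ℤ , 0ℤ) ≡ x
  +ev-none x = identity x R S K
    where
    identity : ∀ x R S K → x + (0ℤ * R + 0ℤ * S + 0ℤ * K) ≡ x
    identity = solve-∀

  +ev-k : ∀ x → x + ev (0ℤ , 0ℤ , 1ℤ) ≡ x + K
  +ev-k x = identity x R S K
    where
    identity : ∀ x R S K → x + (0ℤ * R + 0ℤ * S + 1ℤ * K) ≡ x + K
    identity = solve-∀

  +ev-r : ∀ x → x + ev (1ℤ , 0ℤ , 0ℤ) ≡ x + R
  +ev-r x = identity x R S K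
    where
    identity : ∀ x R S K → x + (1ℤ * R + 0ℤ * S + 0ℤ * K) ≡ x + R
    identity = solve-∀

  +ev-s : ∀ x → x + ev (0ℤ , 1ℤ , 0ℤ) ≡ x + S
  +ev-s x = identity x R S K
    where
    identity : ∀ x R S K → x + (0ℤ * R + 1ℤ * S + 0ℤ * K) ≡ x + S
    identity = solve-∀

  +ev-minus-r : ∀ x → x + ev (-1ℤ , 0ℤ , 0ℤ) ≡ x - R
  +ev-minus-r x = identity x R S K
    where
    identity : ∀ x R S K → x + (-1ℤ * R + 0ℤ * S + 0ℤ * K) ≡ x - R
    identity = solve-∀

  +ev-minus-s : ∀ x → x + ev (0ℤ , -1ℤ , 0ℤ) ≡ x - S
  +ev-minus-s x = identity x R S K
    where
    identity : ∀ x R S K → x + (0ℤ * R + -1ℤ * S + 0ℤ * K) ≡ x - S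
    identity = solve-∀

  minus-plus : ∀ x y → x - y + y ≡ x
  minus-plus = solve-∀

  plus-minus : ∀ x y → x + y - y ≡ x
  plus-minus = solve-∀

  x+K+K≈x : ∀ x → x + K + K ≈ x
  x+K+K≈x x = ≈-trans (≈-reflexive (ℤ.+-assoc x K K))
    (≈-trans (≈-+ (≈-reflexive {x} refl) K+K≈0) (≈-reflexive (ℤ.+-identityʳ x)))

  adjacent : ∀ t x p → Adj r s (vertex t x) (neighbour t x p)
  adjacent 𝕦 x 0F = inj₁ (subst (λ i → Edge r s (u (pos x)) (u i))
    (trans (pos-⊕k x) (cong pos (sym (+ev-k x)))) (uu (pos x)))
  adjacent 𝕦 x 1F = inj₁ (subst (λ y → Edge r s (u (pos x)) (v (pos y))) (sym (+ev-none x)) (uv (pos x)))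
  adjacent 𝕦 x 2F = inj₁ (subst (λ y → Edge r s (u (pos x)) (w (pos y))) (sym (+ev-none x)) (uw (pos x)))
  adjacent 𝕧 x 0F = inj₂ (subst (λ y → Edge r s (u (pos y)) (v (pos x))) (sym (+ev-none x)) (uv (pos x)))
  adjacent 𝕧 x 1F = inj₁ (subst (λ i → Edge r s (v (pos x)) (v i))
    (trans (pos-⊕ x s) (cong pos (sym (+ev-s x)))) (vv (pos x)))
  adjacent 𝕧 x 2F = inj₂ (subst₂ (λ i j → Edge r s (v i) (v j))
    (cong pos (sym (+ev-minus-s x))) (trans (pos-⊕ (x - S) s) (cong pos (minus-plus x S))) (vv (pos (x - S))))
  adjacent 𝕨 x 0F = inj₂ (subst (λ y → Edge r s (u (pos y)) (w (pos x))) (sym (+ev-none x)) (uw (pos x)))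
  adjacent 𝕨 x 1F = inj₁ (subst (λ i → Edge r s (w (pos x)) (w i))
    (trans (pos-⊕ x r) (cong pos (sym (+ev-r x)))) (ww (pos x)))
  adjacent 𝕨 x 2F = inj₂ (subst₂ (λ i j → Edge r s (w i) (w j))
    (cong pos (sym (+ev-minus-r x))) (trans (pos-⊕ (x - R) r) (cong pos (minus-plus x R))) (ww (pos (x - R))))

  head-of-edge : ∀ {a b} → Edge r s a b → ∀ t x → a ≡ vertex t x → ∃ λ p → b ≡ neighbour t x p
  head-of-edge (uu _) 𝕦 x refl = 0F , cong u (trans (pos-⊕k x) (cong pos (sym (+ev-k x))))
  head-of-edge (uv _) 𝕦 x refl = 1F , cong (λ y → v (pos y)) (sym (+ev-none x))
  head-of-edge (uw _) 𝕦 x refl = 2F , cong (λ y → w (pos y)) (sym (+ev-none x))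
  head-of-edge (ww _) 𝕨 x refl = 1F , cong w (trans (pos-⊕ x r) (cong pos (sym (+ev-r x))))
  head-of-edge (vv _) 𝕧 x refl = 1F , cong v (trans (pos-⊕ x s) (cong pos (sym (+ev-s x))))

  predecessor : ∀ i j x → i ⊕ j ≡ pos x → i ≡ pos (x - + toℕ j)
  predecessor i j x eq = trans (pos-toℕ i) (pos-cong
    (≈-trans (≈-reflexive (sym (plus-minus (+ toℕ i) (+ toℕ j))))
             (≈-+ (pos-injective (trans (sym (⊕≡pos i j)) eq)) (≈-reflexive { - + toℕ j} refl))))

  tail-of-edge : ∀ {a b} → Edge r s a b → ∀ t x → b ≡ vertex t x → ∃ λ p → a ≡ neighbour t x p
  -- Here i + k ≡ x gives i ≡ x + k because 2k ≡ 0, so uu′ is port 0F from either end.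
  tail-of-edge (uu i) 𝕦 x eq = 0F , cong u (trans (pos-toℕ i) (pos-cong
    (≈-trans (≈-sym (x+K+K≈x (+ toℕ i))) (≈-trans
      (≈-+ (pos-injective (trans (trans (sym (pos-⊕k (+ toℕ i))) (cong (_⊕ kZ) (sym (pos-toℕ i)))) (u-injective eq)))
           (≈-reflexive refl))
      (≈-reflexive (sym (+ev-k x)))))))
  tail-of-edge (uv _) 𝕧 x refl = 0F , cong (λ y → u (pos y)) (sym (+ev-none x))
  tail-of-edge (uw _) 𝕨 x refl = 0F , cong (λ y → u (pos y)) (sym (+ev-none x))
  tail-of-edge (ww i) 𝕨 x eq = 2F , cong w
    (trans (predecessor i r x (w-injective eq)) (cong pos (sym (+ev-minus-r x))))
  tail-of-edge (vv i) 𝕧 x eq = 2F , cong v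
    (trans (predecessor i s x (v-injective eq)) (cong pos (sym (+ev-minus-s x))))

  port-towards : ∀ t x {b} → Adj r s (vertex t x) b → ∃ λ p → b ≡ neighbour t x p
  port-towards t x (inj₁ edge) = head-of-edge edge t x refl
  port-towards t x (inj₂ edge) = tail-of-edge edge t x refl

  neighbour-back : ∀ t x p → vertex t x ≡ neighbour (next t p) (x + ev (shift t p)) (back t p)
  neighbour-back 𝕦 x 0F = vertex-cong 𝕦 (≈-trans (≈-sym (x+K+K≈x x))
    (≈-reflexive (trans (cong (_+ K) (sym (+ev-k x))) (sym (+ev-k (x + ev (0ℤ , 0ℤ , 1ℤ)))))))
  neighbour-back 𝕦 x 1F = cong (λ y → u (pos y)) (sym (trans (+ev-none _) (+ev-none x)))
  neighbour-back 𝕦 x 2F = cong (λ y → u (pos y)) (sym (trans (+ev-none _) (+ev-none x)))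
  neighbour-back 𝕧 x 0F = cong (λ y → v (pos y)) (sym (trans (+ev-none _) (+ev-none x)))
  neighbour-back 𝕧 x 1F = cong (λ y → v (pos y))
    (sym (trans (+ev-minus-s (x + ev (shift 𝕧 1F))) (trans (cong (_- S) (+ev-s x)) (plus-minus x S))))
  neighbour-back 𝕧 x 2F = cong (λ y → v (pos y))
    (sym (trans (+ev-s (x + ev (shift 𝕧 2F))) (trans (cong (_+ S) (+ev-minus-s x)) (minus-plus x S))))
  neighbour-back 𝕨 x 0F = cong (λ y → w (pos y)) (sym (trans (+ev-none _) (+ev-none x)))
  neighbour-back 𝕨 x 1F = cong (λ y → w (pos y))
    (sym (trans (+ev-minus-r (x + ev (shift 𝕨 1F))) (trans (cong (_- R) (+ev-r x)) (plus-minus x R))))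
  neighbour-back 𝕨 x 2F = cong (λ y → w (pos y))
    (sym (trans (+ev-r (x + ev (shift 𝕨 2F))) (trans (cong (_+ R) (+ev-minus-r x)) (minus-plus x R))))

  -- Connectedness and the span of r, s and k

  reachable : ∀ {a b} → Star (Adj r s) a b → ∀ t o → a ≡ vertex t (ev o) →
    ∃ λ t′ → ∃ λ o′ → b ≡ vertex t′ (ev o′)
  reachable ε t o eq = t , o , eq
  reachable (adj ◅ path) t o refl with port-towards t (ev o) adj
  ... | p , refl = reachable path (next t p) (o ⊞ shift t p) (cong (vertex (next t p)) (sym (ev-⊞ o (shift t p))))

  -- The offset collected along a path from u₀ to u₁ evaluates to 1, so r, s and k span ℤ/2k.
  connected⇒ev≈1 : Connected → ∃ λ o → ev o ≈ 1ℤ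
  connected⇒ev≈1 connected
    with reachable (connected (vertex 𝕦 (ev (0ℤ , 0ℤ , 0ℤ))) (vertex 𝕦 1ℤ)) 𝕦 (0ℤ , 0ℤ , 0ℤ) refl
  ... | t , o , eq = o , ≈-sym (proj₂ (vertex-injective 𝕦 t eq))

  -- Relations between a single generator g and k

  record Realises (c : Config) (g : ℤ) : Set where
    open Config c
    field
      r≈ : R ≈ c₁ * g + d₁ * K
      s≈ : S ≈ c₂ * g + d₂ * K

  ev-reduce : ∀ {c g} → Realises c g → ∀ o → ev o ≈ proj₁ (reduce c o) * g + proj₂ (reduce c o) * K
  ev-reduce {config c₁ d₁ c₂ d₂} {g} realises (a , b , e) =
    ≈-trans (≈-+ (≈-+ (≈-* a r≈) (≈-* b s≈)) (≈-reflexive refl)) (≈-reflexive (identity a b e c₁ d₁ c₂ d₂ g K))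
    where
    open Realises realises
    identity : ∀ a b e c₁ d₁ c₂ d₂ g K →
      a * (c₁ * g + d₁ * K) + b * (c₂ * g + d₂ * K) + e * K ≡
      (a * c₁ + b * c₂) * g + (a * d₁ + b * d₂ + e) * K
    identity = solve-∀

  vanishing⇒holds : ∀ {c g} → Realises c g → ∀ o → Vanishing (reduce c o) → Holds o
  vanishing⇒holds {c} {g} realises o (x≡0 , divides q e≡) = ≈-trans (ev-reduce realises o)
    (congruent (divides q (trans (cong₂ (λ x e → x * g + e * K - 0ℤ) x≡0 e≡) (identity q g K))))
    where
    identity : ∀ q g K → 0ℤ * g + (q * + 2) * K - 0ℤ ≡ q * (+ 2 * K)
    identity = solve-∀

  Generates : ℤ → Set
  Generates g = ∃ λ α → ∃ λ γ → α * g + γ * K ≈ 1ℤ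

  ev≈1⇒generates : ∀ {c g} → Realises c g → (∃ λ o → ev o ≈ 1ℤ) → Generates g
  ev≈1⇒generates {c} realises (o , ev≈1) =
    proj₁ (reduce c o) , proj₂ (reduce c o) , ≈-trans (≈-sym (ev-reduce realises o)) ev≈1

  connected⇒generates : ∀ {c g} → Realises c g → Connected → Generates g
  connected⇒generates realises connected = ev≈1⇒generates realises (connected⇒ev≈1 connected)

  -- Modulo k the hypotheses read α g ≡ 1 and x g ≡ 0, whence x ≡ α x g ≡ 0.
  k∣coefficient : ∀ {g} x e → Generates g → x * g + e * K ≈ 0ℤ → K ∣ x
  k∣coefficient {g} x e (α , γ , congruent h₁) (congruent h₀) = subst (K ∣_) (identity α γ x e g K)
    (∣m∣n⇒∣m+n (∣m∣n⇒∣m-n (∣n⇒∣m*n α (∣-trans K∣M h₀)) (∣n⇒∣m*n x (∣-trans K∣M h₁)))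
      (∣n⇒∣m*n (x * γ - α * e) ∣-refl))
    where
    K∣M : K ∣ M
    K∣M = divides (+ 2) refl
    identity : ∀ α γ x e g K →
      α * (x * g + e * K - 0ℤ) - x * (α * g + γ * K - 1ℤ) + (x * γ - α * e) * K ≡ x
    identity = solve-∀

  -- With g = ρ + 2h, the part 2hx of x g vanishes modulo 2k since k ∣ x; only the parity ρ of g is
  -- left.
  small : ∀ {g} ρ h → g ≡ ρ + h * + 2 → Generates g → ∀ x e → x * g + e * K ≈ 0ℤ → Small k ρ (x , e)
  small ρ h refl generates x e relation@(congruent h₀) = K∣x ,
    subst (M ∣_) (identity ρ h x e K) (∣m∣n⇒∣m-n h₀ (∣n⇒∣m*n h (*-monoʳ-∣ (+ 2) K∣x)))
    where
    K∣x : K ∣ x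
    K∣x = k∣coefficient x e generates relation
    identity : ∀ ρ h x e K → (x * (ρ + h * + 2) + e * K - 0ℤ) - h * (+ 2 * x) ≡ x * ρ + e * K
    identity = solve-∀

  -- A nonzero multiple x of k has absolute value at least k, and for x = 0 the relation 2k ∣ e k
  -- makes e even. The bound 25 exceeds every |x| that occurs: the largest is 8 · 3, from eight
  -- steps of s when s = ±3r or of r when r = ±3s.
  large : ∀ {g} → 25 ℕ.≤ k → Generates g → ∀ x e → x * g + e * K ≈ 0ℤ → Large (x , e)
  large {g} 25≤k generates x e relation with x ℤ.≟ 0ℤ
  ... | no x≢0 = inj₂ (ℕ.≤-trans 25≤k (ℕ.∣⇒≤ ⦃ ℕ.≢-nonZero λ eq → x≢0 (ℤ.∣i∣≡0⇒i≡0 eq) ⦄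
          (∣⇒∣ᵤ (k∣coefficient x e generates relation))))
  ... | yes refl = inj₁ (refl , *-cancelʳ-∣ K (subst (M ∣_) (identity g e K) (difference relation)))
    where
    identity : ∀ g e K → 0ℤ * g + e * K - 0ℤ ≡ e * K
    identity = solve-∀

  -- For even k and even g the number α g + γ k is even, hence not congruent to 1 modulo 2k.
  even-k⇒odd-generator : ∀ {h} → + 2 ∣ K → ¬ Generates (0ℤ + h * + 2)
  even-k⇒odd-generator {h} (divides q K≡) (α , γ , congruent (divides m eq)) =
    contradiction (∣⇒∣ᵤ (divides (α * h + γ * q - m * K) 1≡)) λ 2∣1 → ℕ.1+n≰n (ℕ.∣⇒≤ 2∣1)
    where
    open ≡-Reasoning
    solve-for-1 : ∀ α h γ K → 1ℤ ≡ (α * (0ℤ + h * + 2) + γ * K) - (α * (0ℤ + h * + 2) + γ * K - 1ℤ)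
    solve-for-1 = solve-∀
    factor : ∀ α h γ q m K → (α * (0ℤ + h * + 2) + γ * (q * + 2)) - m * (+ 2 * K) ≡ (α * h + γ * q - m * K) * + 2
    factor = solve-∀
    1≡ : 1ℤ ≡ (α * h + γ * q - m * K) * + 2
    1≡ = begin
      1ℤ
        ≡⟨ solve-for-1 α h γ K ⟩
      (α * (0ℤ + h * + 2) + γ * K) - (α * (0ℤ + h * + 2) + γ * K - 1ℤ)
        ≡⟨ cong₂ (λ y z → (α * (0ℤ + h * + 2) + γ * y) - z) K≡ eq ⟩
      (α * (0ℤ + h * + 2) + γ * (q * + 2)) - m * (+ 2 * K)
        ≡⟨ factor α h γ q m K ⟩
      (α * h + γ * q - m * K) * + 2 ∎

  solutions : ∀ {c g ls} → Realises c g → All (Any Holds) ls → ∀ Q →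
    (∀ x e → x * g + e * K ≈ 0ℤ → Q (x , e)) → All (Solvable c Q) ls
  solutions realises all-hold Q f =
    All.map (Any.map λ {o} holds → f _ _ (≈-trans (≈-sym (ev-reduce realises o)) holds)) all-hold

  unsolvable⇒⊥ : ∀ {c g ls} → Realises c g → Generates g → 9 ℕ.≤ k → Unsolvable c ls → ¬ All (Any Holds) ls
  unsolvable⇒⊥ {c} {g} {ls} realises generates 9≤k (none-large , none-small) all-hold with k ℕ.<? 25
  ... | no k≮25 = none-large (solutions realises all-hold Large (large (ℕ.≮⇒≥ k≮25) generates))
  ... | yes k<25 = by-parity (subst Claim index≡ (none-small index)) (parity g)
    where
    index : Fin 16
    index = fromℕ< {k ℕ.∸ 9} (ℕ.∸-monoˡ-< k<25 9≤k)
    index≡ : 9 ℕ.+ toℕ index ≡ k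
    index≡ = trans (cong (9 ℕ.+_) (toℕ-fromℕ< _)) (ℕ.m+[n∸m]≡n 9≤k)
    Claim : ℕ → Set
    Claim k = ¬ All (Solvable c (Small k 1ℤ)) ls × (+ 2 ∣ + k ⊎ ¬ All (Solvable c (Small k 0ℤ)) ls)
    by-parity : Claim k → (∃ λ h → g ≡ 0ℤ + h * + 2) ⊎ (∃ λ h → g ≡ 1ℤ + h * + 2) → _
    by-parity (none-odd , _) (inj₂ (h , g≡)) =
      none-odd (solutions realises all-hold (Small k 1ℤ) (small 1ℤ h g≡ generates))
    by-parity (_ , inj₁ k-even) (inj₁ (h , refl)) = even-k⇒odd-generator {h} k-even generates
    by-parity (_ , inj₂ none-even) (inj₁ (h , g≡)) =
      none-even (solutions realises all-hold (Small k 0ℤ) (small 0ℤ h g≡ generates))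

  -- Solving a relation for r or s

  solve-for-s : ∀ {a b e} → b * b ≡ 1ℤ → Holds (a , b , e) → Realises (config 1ℤ 0ℤ (- (b * a)) (- (b * e))) R
  solve-for-s {a} {b} {e} b²≡1 (congruent h) = record
    { r≈ = ≈-reflexive (trivially R K)
    -- Multiply the relation by b, which is its own inverse.
    ; s≈ = congruent (subst (M ∣_) (trans (expand a b e R S K)
             (trans (cong (λ c → c * S - (- (b * a) * R + - (b * e) * K)) b²≡1)
               (cong (_- (- (b * a) * R + - (b * e) * K)) (ℤ.*-identityˡ S)))) (∣n⇒∣m*n b h))
    }
    where
    trivially : ∀ R K → R ≡ 1ℤ * R + 0ℤ * K
    trivially = solve-∀
    expand : ∀ a b e R S K → b * (a * R + b * S + e * K - 0ℤ) ≡ (b * b) * S - (- (b * a) * R + - (b * e) * K)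
    expand = solve-∀

  solve-for-r : ∀ {a b e} → a * a ≡ 1ℤ → Holds (a , b , e) → Realises (config (- (a * b)) (- (a * e)) 1ℤ 0ℤ) S
  solve-for-r {a} {b} {e} a²≡1 (congruent h) = record
    { r≈ = congruent (subst (M ∣_) (trans (expand a b e R S K)
             (trans (cong (λ c → c * R - (- (a * b) * S + - (a * e) * K)) a²≡1)
               (cong (_- (- (a * b) * S + - (a * e) * K)) (ℤ.*-identityˡ R)))) (∣n⇒∣m*n a h))
    ; s≈ = ≈-reflexive (trivially S K)
    }
    where
    trivially : ∀ S K → S ≡ 1ℤ * S + 0ℤ * K
    trivially = solve-∀
    expand : ∀ a b e R S K → a * (a * R + b * S + e * K - 0ℤ) ≡ (a * a) * R - (- (a * b) * S + - (a * e) * K)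
    expand = solve-∀

  -- Halving the relation leaves a r + b s = m k for some integer m. Multiplied by b, this is s = -b
  -- a r + b m k, where modulo 2k only the parity of b m counts.
  solve-half : ∀ {a b} → b * b ≡ 1ℤ → Holds (+ 2 * a , + 2 * b , 0ℤ) →
    Realises (config 1ℤ 0ℤ (- (b * a)) 0ℤ) R ⊎ Realises (config 1ℤ 0ℤ (- (b * a)) 1ℤ) R
  solve-half {a} {b} b²≡1 (congruent h) with *-cancelˡ-∣ (+ 2) (subst (M ∣_) (double a b R S K) h)
    where
    double : ∀ a b R S K → (+ 2 * a) * R + (+ 2 * b) * S + 0ℤ * K - 0ℤ ≡ + 2 * (a * R + b * S)
    double = solve-∀
  ... | divides m eq = by-parity (parity (b * m))
    where
    open ≡-Reasoning
    trivially : ∀ R K → R ≡ 1ℤ * R + 0ℤ * K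
    trivially = solve-∀
    expand : ∀ a b ρ R S K → (b * b) * S - (- (b * a) * R + ρ * K) ≡ b * (a * R + b * S) - ρ * K
    expand = solve-∀
    regroup : ∀ b m ρ K → b * (m * K) - ρ * K ≡ (b * m) * K - ρ * K
    regroup = solve-∀
    cancel : ∀ ρ h K → (ρ + h * + 2) * K - ρ * K ≡ h * (+ 2 * K)
    cancel = solve-∀
    residue : ∀ ρ {h} → b * m ≡ ρ + h * + 2 → S ≈ - (b * a) * R + ρ * K
    residue ρ {h} bm≡ = congruent (divides h (begin
      S - (- (b * a) * R + ρ * K)           ≡⟨ cong (_- (- (b * a) * R + ρ * K)) (sym (ℤ.*-identityˡ S)) ⟩
      1ℤ * S - (- (b * a) * R + ρ * K)      ≡⟨ cong (λ c → c * S - (- (b * a) * R + ρ * K)) (sym b²≡1) ⟩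
      (b * b) * S - (- (b * a) * R + ρ * K) ≡⟨ expand a b ρ R S K ⟩
      b * (a * R + b * S) - ρ * K           ≡⟨ cong (λ y → b * y - ρ * K) eq ⟩
      b * (m * K) - ρ * K                   ≡⟨ regroup b m ρ K ⟩
      (b * m) * K - ρ * K                   ≡⟨ cong (λ y → y * K - ρ * K) bm≡ ⟩
      (ρ + h * + 2) * K - ρ * K             ≡⟨ cancel ρ h K ⟩
      h * M                                 ∎))
    by-parity : (∃ λ h → b * m ≡ 0ℤ + h * + 2) ⊎ (∃ λ h → b * m ≡ 1ℤ + h * + 2) → _
    by-parity (inj₁ (h , bm≡)) =
      inj₁ (record { r≈ = ≈-reflexive (trivially R K) ; s≈ = residue 0ℤ {h} bm≡ })
    by-parity (inj₂ (h , bm≡)) =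
      inj₂ (record { r≈ = ≈-reflexive (trivially R K) ; s≈ = residue 1ℤ {h} bm≡ })

  -- Closed walks of the graph and their offsets

  module _ (three-regular : ThreeRegular) where

    -- The three distinct neighbours given by 3-regularity are reached through ports, which yields
    -- an injective and thus surjective map of ports. Degenerate r and s, such as 2s ≡ 0, are
    -- excluded here.
    neighbour-injective : ∀ t x {p q} → neighbour t x p ≡ neighbour t x q → p ≡ q
    neighbour-injective t x {p} {q} eq = begin
      p             ≡⟨ sym (proj₂ (onto p)) ⟩
      port (i p)    ≡⟨ cong port (g-injective {i p} {i q} (begin
        g (i p)                    ≡⟨ at-port (i p) ⟩
        neighbour t x (port (i p)) ≡⟨ cong (neighbour t x) (proj₂ (onto p)) ⟩
        neighbour t x p            ≡⟨ eq ⟩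
        neighbour t x q            ≡⟨ cong (neighbour t x) (sym (proj₂ (onto q))) ⟩
        neighbour t x (port (i q)) ≡⟨ sym (at-port (i q)) ⟩
        g (i q)                    ∎)) ⟩
      port (i q)    ≡⟨ proj₂ (onto q) ⟩
      q             ∎
      where
      open ≡-Reasoning
      nbrs = three-regular (vertex t x)
      g : Port → Vertex
      g 0F = proj₁ nbrs
      g 1F = proj₁ (proj₂ nbrs)
      g 2F = proj₁ (proj₂ (proj₂ nbrs))
      facts = proj₂ (proj₂ (proj₂ nbrs))
      g-injective : ∀ {i j} → g i ≡ g j → i ≡ j
      g-injective {0F} {0F} _ = refl
      g-injective {1F} {1F} _ = refl
      g-injective {2F} {2F} _ = refl
      g-injective {0F} {1F} e = contradiction e (proj₁ facts)
      g-injective {1F} {0F} e = contradiction (sym e) (proj₁ facts)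
      g-injective {0F} {2F} e = contradiction e (proj₁ (proj₂ facts))
      g-injective {2F} {0F} e = contradiction (sym e) (proj₁ (proj₂ facts))
      g-injective {1F} {2F} e = contradiction e (proj₁ (proj₂ (proj₂ facts)))
      g-injective {2F} {1F} e = contradiction (sym e) (proj₁ (proj₂ (proj₂ facts)))
      adj : ∀ i → Adj r s (vertex t x) (g i)
      adj 0F = proj₁ (proj₂ (proj₂ (proj₂ facts)))
      adj 1F = proj₁ (proj₂ (proj₂ (proj₂ (proj₂ facts))))
      adj 2F = proj₁ (proj₂ (proj₂ (proj₂ (proj₂ (proj₂ facts)))))
      port : Port → Port
      port i = proj₁ (port-towards t x (adj i))
      at-port : ∀ i → g i ≡ neighbour t x (port i)
      at-port i = proj₂ (port-towards t x (adj i))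
      onto : ∀ p → ∃ λ i → port i ≡ p
      onto = injective⇒surjective λ {i} {j} e →
        g-injective (trans (at-port i) (trans (cong (neighbour t x) e) (sym (at-port j))))
      i : Port → Port
      i p = proj₁ (onto p)

    module _ (t* : Kind) (x* : ℤ) (p* : Port) where

      private
        y z : Vertex
        y = neighbour t* x* p*
        z = vertex t* x*

      advance : ∀ t p o → neighbour t (x* + ev o) p ≡ vertex (next t p) (x* + ev (o ⊞ shift t p))
      advance t p o = cong (vertex (next t p))
        (trans (ℤ.+-assoc x* (ev o) _) (cong (_+_ x*) (sym (ev-⊞ o (shift t p)))))

      retreat : ∀ t p o → vertex t (x* + ev o) ≡ neighbour (next t p) (x* + ev (o ⊞ shift t p)) (back t p)
      retreat t p o = trans (neighbour-back t (x* + ev o) p) (cong (λ x → neighbour (next t p) x (back t p))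
        (trans (ℤ.+-assoc x* (ev o) _) (cong (_+_ x*) (sym (ev-⊞ o (shift t p))))))

      -- Induction with the invariant that the walk stands at x* + `ev o`. Ending at x* forces
      -- `ev o` ≈ 0, and since distinct ports lead to distinct neighbours the last port is p*.
      walk⇒ending : ∀ {n a b} t p o → NonBacktracking y z n a b →
        a ≡ neighbour t (x* + ev o) p → b ≡ vertex t (x* + ev o) → Any Holds (endings t* p* n t p o)
      walk⇒ending t p o stop eq-a eq-b with vertex-injective t* t eq-b
      ... | refl , x*≈ with t* ≟ᵏ t* | p ≟ᶠ p*
      ...   | no t≢   | _      = contradiction refl t≢
      ...   | yes _   | yes _  = here (ev≈0 x*≈)
        where
        cancel : ∀ x y → x + y - x ≡ y
        cancel = solve-∀
        ev≈0 : x* ≈ x* + ev o → ev o ≈ 0ℤ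
        ev≈0 h = ≈-trans (≈-reflexive (sym (cancel x* (ev o))))
          (≈-trans (≈-+ (≈-sym h) (≈-reflexive { - x*} refl)) (≈-reflexive (ℤ.+-inverseʳ x*)))
      ...   | yes _   | no p≢ = contradiction
        (sym (neighbour-injective t* x* (trans eq-a (neighbour-cong t* p (≈-sym x*≈))))) p≢
      walk⇒ending {suc n} t p o (step adj a≢c walk) refl refl with port-towards t (x* + ev o) adj
      ... | j , refl with other-port {p} {j} (λ eq → a≢c (cong (neighbour t (x* + ev o)) eq))
      ...   | inj₁ refl = Any.++⁺ˡ (walk⇒ending _ _ _ walk (retreat t _ o) (advance t _ o))
      ...   | inj₂ refl = Any.++⁺ʳ _ (walk⇒ending _ _ _ walk (retreat t _ o) (advance t _ o))

      -- Conversely, a different port leads to a different neighbour, so the enumerated walks do not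
      -- backtrack.
      ending⇒walk : ∀ n {a b} t p o → Any Holds (endings t* p* n t p o) →
        a ≡ neighbour t (x* + ev o) p → b ≡ vertex t (x* + ev o) → NonBacktracking y z n a b
      ending⇒walk zero t p o ending eq-a eq-b with t ≟ᵏ t* | p ≟ᶠ p* | ending
      ... | yes refl | yes refl | here h = subst₂ (NonBacktracking y z 0)
        (sym (trans eq-a (neighbour-cong t* p* x*+ev≈x*))) (sym (trans eq-b (vertex-cong t* x*+ev≈x*))) stop
        where
        x*+ev≈x* : x* + ev o ≈ x*
        x*+ev≈x* = ≈-trans (≈-+ (≈-reflexive {x*} refl) h) (≈-reflexive (ℤ.+-identityʳ x*))
      ending⇒walk (suc n) t p o ending refl refl =
        [ via (other₁ p) (other₁-≢ p) , via (other₂ p) (other₂-≢ p) ]′ (Any.++⁻ _ ending)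
        where
        via : ∀ j → p ≢ j → Any Holds (endings t* p* n (next t j) (back t j) (o ⊞ shift t j)) →
          NonBacktracking y z (suc n) (neighbour t (x* + ev o) p) (vertex t (x* + ev o))
        via j p≢j rest = step (adjacent t (x* + ev o) j)
          (λ eq → p≢j (neighbour-injective t (x* + ev o) eq))
          (ending⇒walk n _ _ _ rest (retreat t j o) (advance t j o))

    -- A record, so that its arguments can be inferred and the long concrete lists stay folded.
    record Returns (n : ℕ) (t : Kind) (p q : Port) : Set where
      constructor closes
      field closing : Any Holds (returns n t p q)
    open Returns

    walk⇒returns : ∀ {n} t x p q →
      NonBacktracking (neighbour t x p) (vertex t x) n (vertex t x) (neighbour t x q) → Returns n t p q
    walk⇒returns t x p q walk =
      closes (walk⇒ending t x p (next t q) (back t q) (shift t q) walk (neighbour-back t x q) refl)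

    returns⇒walk : ∀ {n} t x p q → Returns n t p q →
      NonBacktracking (neighbour t x p) (vertex t x) n (vertex t x) (neighbour t x q)
    returns⇒walk {n} t x p q (closes holds) =
      ending⇒walk t x p n (next t q) (back t q) (shift t q) holds (neighbour-back t x q) refl

    trivial⇒returns : ∀ {n} t p q → Any Trivial (returns n t p q) → Returns n t p q
    trivial⇒returns _ _ _ trivial = closes (Any.map (λ {o} → trivial⇒holds o) trivial)
      where
      identity : ∀ q R S K → 0ℤ * R + 0ℤ * S + (q * + 2) * K - 0ℤ ≡ q * (+ 2 * K)
      identity = solve-∀
      trivial⇒holds : ∀ o → Trivial o → Holds o
      trivial⇒holds (_ , _ , _) (refl , refl , divides q refl) = congruent (divides q (identity q R S K))

    -- Automorphisms as permutations of ports

    record PortMap (σ : Automorphism) (t : Kind) (x : ℤ) (t′ : Kind) (x′ : ℤ) : Set where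
      field
        base       : apply σ (vertex t x) ≡ vertex t′ x′
        port       : Port → Port
        compatible : ∀ q → apply σ (neighbour t x (port q)) ≡ neighbour t′ x′ q

      port-injective : ∀ {p q} → port p ≡ port q → p ≡ q
      port-injective {p} {q} eq = neighbour-injective t′ x′
        (trans (sym (compatible p)) (trans (cong (λ j → apply σ (neighbour t x j)) eq) (compatible q)))

      returns-image : ∀ {n p q} → Returns n t (port p) (port q) → Returns n t′ p q
      returns-image {n} {p} {q} holds = walk⇒returns t′ x′ p q
        (transport (compatible p) base (compatible q) (map-walk σ (returns⇒walk t x (port p) (port q) holds)))
        where
        transport : ∀ {a a′ b b′ c c′} → a ≡ a′ → b ≡ b′ → c ≡ c′ →
          NonBacktracking a b n b c → NonBacktracking a′ b′ n b′ c′
        transport refl refl refl walk = walk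

    open PortMap

    -- A neighbour of the image has a preimage next to the source, because σ reflects edges; hence
    -- `port` runs from the image back to the source.
    portMap : ∀ {t x t′ x′} σ → apply σ (vertex t x) ≡ vertex t′ x′ → PortMap σ t x t′ x′
    portMap {t} {x} {t′} {x′} σ base = record
      { base       = base
      ; port       = λ q → proj₁ (towards q)
      ; compatible = λ q → trans (cong (apply σ) (sym (proj₂ (towards q)))) (proj₂ (proj₂ (preimage q)))
      }
      where
      preimage : ∀ q → ∃ λ y → Adj r s (vertex t x) y × apply σ y ≡ neighbour t′ x′ q
      preimage q = lift-neighbour σ (subst (λ y → Adj r s y (neighbour t′ x′ q)) (sym base) (adjacent t′ x′ q))
      towards : ∀ q → ∃ λ p → proj₁ (preimage q) ≡ neighbour t x p
      towards q = port-towards t x (proj₁ (proj₂ (preimage q)))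

    Detours : ℕ → Kind → Set
    Detours n t = ∀ p q → p ≢ q → p ≡ 0F ⊎ q ≡ 0F → Returns n t p q

    -- Only a pair without 0F can fail to return, so neither p nor q is 0F. The preimage pair fails
    -- to return as well and avoids 0F too, so the remaining ports, both 0F, correspond to each
    -- other.
    fixes-0F : ∀ {n p q} → Detours n 𝕦 → p ≢ q → ¬ Returns n 𝕦 p q →
      ∀ {σ t x x′} → Detours n t → (π : PortMap σ t x 𝕦 x′) → port π 0F ≡ 0F
    fixes-0F {n} {p} {q} detours p≢q no-return {t = t} detours′ π =
      trans (cong (port π) (sym i≡0F)) i↦0F
      where
      i : Port
      i = proj₁ (injective⇒surjective (port-injective π) 0F)
      i↦0F : port π i ≡ 0F
      i↦0F = proj₂ (injective⇒surjective (port-injective π) 0F)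
      away : port π p ≡ 0F ⊎ port π q ≡ 0F → ⊥
      away at-0F = no-return (returns-image π (detours′ _ _ (λ eq → p≢q (port-injective π eq)) at-0F))
      i≡0F : i ≡ 0F
      i≡0F = third-port p q i p≢q (λ eq → no-return (detours p q p≢q (inj₁ eq)))
        (λ eq → no-return (detours p q p≢q (inj₂ eq)))
        (λ i≡p → away (inj₁ (trans (cong (port π) (sym i≡p)) i↦0F)))
        (λ i≡q → away (inj₂ (trans (cong (port π) (sym i≡q)) i↦0F)))

    -- Consequences of vertex-transitivity

    module _ (transitive : VertexTransitive) where

      portMap-between : ∀ t t′ → ∃ λ σ → PortMap σ t 0ℤ t′ 0ℤ
      portMap-between t t′ = proj₁ moved , portMap (proj₁ moved) (proj₂ moved)
        where
        moved : Σ Automorphism λ σ → apply σ (vertex t 0ℤ) ≡ vertex t′ 0ℤ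
        moved = transitive (vertex t 0ℤ) (vertex t′ 0ℤ)

      -- Otherwise port 0F would be preserved along 𝕨 → 𝕦, so an edge u–w would be carried to an edge
      -- u–u′, although port 0F is preserved along 𝕦 → 𝕦 at its other end as well.
      returns-at-𝕦 : ∀ {n} → (∀ t → Detours n t) → ∀ p q → p ≢ q → ¬ ¬ Returns n 𝕦 p q
      returns-at-𝕦 detours p q p≢q no-return = absurd (apply-injective σ σ-image)
        where
        σ : Automorphism
        σ = proj₁ (portMap-between 𝕨 𝕦)
        π : PortMap σ 𝕨 0ℤ 𝕦 0ℤ
        π = proj₂ (portMap-between 𝕨 𝕦)
        x₁ x₂ : ℤ
        x₁ = 0ℤ + ev (shift 𝕨 0F)
        x₂ = 0ℤ + ev (shift 𝕦 0F)
        π0 : port π 0F ≡ 0F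
        π0 = fixes-0F (detours 𝕦) p≢q no-return (detours 𝕨) π
        π′ : PortMap σ 𝕦 x₁ 𝕦 x₂
        π′ = portMap σ (trans (cong (λ j → apply σ (neighbour 𝕨 0ℤ j)) (sym π0)) (compatible π 0F))
        π′0 : port π′ 0F ≡ 0F
        π′0 = fixes-0F (detours 𝕦) p≢q no-return (detours 𝕦) π′
        σ-image : apply σ (neighbour 𝕦 x₁ 0F) ≡ apply σ (vertex 𝕨 0ℤ)
        σ-image = trans (cong (λ j → apply σ (neighbour 𝕦 x₁ j)) (sym π′0))
          (trans (compatible π′ 0F) (trans (sym (neighbour-back 𝕦 0ℤ 0F)) (sym (base π))))
        absurd : neighbour 𝕦 x₁ 0F ≢ vertex 𝕨 0ℤ
        absurd ()

      -- Walks are directed, and σ may carry either order of {uv, uw}, or a pair with uu′, to (1F,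
      -- 2F). The detours cover the latter.
      returns-everywhere : ∀ {n} → Detours n 𝕦 → Returns n 𝕦 1F 2F → Returns n 𝕦 2F 1F →
        ∀ t → Returns n t 1F 2F
      returns-everywhere {n} detours r₁₂ r₂₁ t =
        returns-image π (all (port π 1F) (port π 2F) λ eq → contradiction (port-injective π eq) λ ())
        where
        π : PortMap (proj₁ (portMap-between 𝕦 t)) 𝕦 0ℤ t 0ℤ
        π = proj₂ (portMap-between 𝕦 t)
        all : ∀ p q → p ≢ q → Returns n 𝕦 p q
        all 0F q  p≢q = detours 0F q p≢q (inj₁ refl)
        all p  0F p≢q = detours p 0F p≢q (inj₂ refl)
        all 1F 2F _   = r₁₂
        all 2F 1F _   = r₂₁
        all 1F 1F p≢q = contradiction refl p≢q
        all 2F 2F p≢q = contradiction refl p≢q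

      -- Wherever wu is sent, every pair at u that contains its image lies on a hexagon, and one
      -- such pair contains uu′.
      hexagons-meet-uu : Detours 5 𝕨 → ¬ Returns 5 𝕦 0F 1F → ¬ Returns 5 𝕦 0F 2F → ⊥
      hexagons-meet-uu detours no₁ no₂ = meets (injective⇒surjective (port-injective π) 0F)
        where
        π : PortMap (proj₁ (portMap-between 𝕨 𝕦)) 𝕨 0ℤ 𝕦 0ℤ
        π = proj₂ (portMap-between 𝕨 𝕦)
        image : ∀ p q → p ≢ q → port π p ≡ 0F ⊎ port π q ≡ 0F → Returns 5 𝕦 p q
        image p q p≢q at-0F = returns-image π
          (detours (port π p) (port π q) (λ eq → p≢q (port-injective π eq)) at-0F)
        meets : (∃ λ i → port π i ≡ 0F) → ⊥
        meets (0F , eq) = no₁ (image 0F 1F (λ ()) (inj₁ eq))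
        meets (1F , eq) = no₁ (image 0F 1F (λ ()) (inj₂ eq))
        meets (2F , eq) = no₂ (image 0F 2F (λ ()) (inj₂ eq))

      -- The contradiction for k ≥ 9

      module _ (connected : Connected) (9≤k : 9 ℕ.≤ k) where

        refuted⇒⊥ : ∀ {c g} → Realises c g → Refuted c →
          Returns 7 𝕧 1F 2F → Returns 7 𝕨 1F 2F → Returns 9 𝕦 1F 2F → ⊥
        refuted⇒⊥ {c} {g} realises refuted v₈ w₈ u₁₀ = by-case refuted
          where
          generates : Generates g
          generates = connected⇒generates realises connected
          by-case : Refuted c → ⊥
          by-case (inj₁ unsolvable) = unsolvable⇒⊥ realises generates 9≤k unsolvable
            (closing v₈ ∷ closing w₈ ∷ closing u₁₀ ∷ [])
          by-case (inj₂ (hexagons , unsolvable₁ , unsolvable₂)) = hexagons-meet-uu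
            (λ p q p≢q at-0F → closes (Any.map (λ {o} → vanishing⇒holds realises o) (hexagons p q p≢q at-0F)))
            (λ h → unsolvable⇒⊥ realises generates 9≤k unsolvable₁ (closing h ∷ []))
            (λ h → unsolvable⇒⊥ realises generates 9≤k unsolvable₂ (closing h ∷ []))

        impossible⇒⊥ : Returns 7 𝕧 1F 2F → Returns 7 𝕨 1F 2F → Returns 9 𝕦 1F 2F →
          ∀ o → Impossible o → ¬ Holds o
        impossible⇒⊥ v₈ w₈ u₁₀ (a , b , e) (inj₁ (b²≡1 , refuted)) holds =
          refuted⇒⊥ (solve-for-s {a} {b} {e} b²≡1 holds) refuted v₈ w₈ u₁₀
        impossible⇒⊥ v₈ w₈ u₁₀ (a , b , e) (inj₂ (inj₁ (a²≡1 , refuted))) holds =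
          refuted⇒⊥ (solve-for-r {a} {b} {e} a²≡1 holds) refuted v₈ w₈ u₁₀
        impossible⇒⊥ v₈ w₈ u₁₀ (a , b , e)
          (inj₂ (inj₂ (a≡ , b≡ , e≡ , b′²≡1 , refuted₀ , refuted₁))) holds =
          [ (λ realises → refuted⇒⊥ realises refuted₀ v₈ w₈ u₁₀)
          , (λ realises → refuted⇒⊥ realises refuted₁ v₈ w₈ u₁₀)
          ]′ (solve-half {a /ℕ 2} {b /ℕ 2} b′²≡1 (subst Holds (cong₂ _,_ a≡ (cong₂ _,_ b≡ e≡)) holds))

        not-vertex-transitive : ⊥
        not-vertex-transitive =
          -- The goal is ⊥, so each doubly negated walk may be used as if it were given.
          returns-at-𝕦 octagons 1F 2F (λ ()) λ u₁₂ →
          returns-at-𝕦 octagons 2F 1F (λ ()) λ u₂₁ →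
          returns-at-𝕦 decagons 1F 2F (λ ()) λ u₁₀ →
          let everywhere = returns-everywhere (octagons 𝕦) u₁₂ u₂₁
              (_ , holds , impossible) = find-in (closing u₁₂) all-impossible
          in impossible⇒⊥ (everywhere 𝕧) (everywhere 𝕨) u₁₀ _ impossible holds
          where
          octagons : ∀ t → Detours 7 t
          octagons t p q p≢q at-0F = trivial⇒returns t p q (detour₈ t p q p≢q at-0F)
          decagons : ∀ t → Detours 9 t
          decagons t p q p≢q at-0F = trivial⇒returns t p q (detour₁₀ t p q p≢q at-0F)
          find-in : ∀ {P Q : Offset → Set} {l} → Any P l → All Q l → ∃ λ o → P o × Q o
          find-in (here p)  (q ∷ _)  = _ , p , q
          find-in (there i) (_ ∷ qs) = find-in i qs

open import Data.Nat using (_*_; _≤_)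

theorem7p2 : (k : ℕ) .{{_ : NonZero k}} → (r s : T4.Z k) →
    let open Graph (T4.Adj k r s) in
    Cubic → Tricirculant → 54 ≤ 3 * (2 * k) → ¬ VertexTransitive
theorem7p2 k r s (_ , connected , three-regular) _ 54≤6k transitive =
  Cover.not-vertex-transitive k r s three-regular transitive connected
    -- The order is 6k and 54 = 6 · 9, so k ≥ 9.
    (ℕ.*-cancelˡ-≤ 6 (subst (54 ≤_) (sym (ℕ.*-assoc 3 2 k)) 54≤6k))
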